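{- Let $X$ be a finite set with $|X|\ge 2$ and let $\mathbb{M}_X$ be the free monoid with basis $X$. The arithmetical hierarchy ${\mathcal H}(\mathbb{M}_X)$ over $\mathbb{M}_X$ is proper, that is, $\Sigma_n(\mathbb{M}_X)\neq\Sigma_{n+1}(\mathbb{M}_X)$ for every $n\in\mathbb{N}$.
   Context: A formula in prenex normal form $Q_1y_1\dots Q_sy_s\,\phi_0$ ($\phi_0$ quantifier-free) is a $\Sigma_n$ formula (resp. $\Pi_n$ formula) if its quantifier sequence begins with $\exists$ (resp. $\forall$) and alternates $n-1$ times between series of existential and universal quantifiers. For a structure $\mathbb{B}$, $\Sigma_n(\mathbb{B})$ (resp. $\Pi_n(\mathbb{B})$) is the set of all subsets of $\mathbb{B}^m$, $m\in\mathbb{N}$, definable in $\mathbb{B}$ by $\Sigma_n$ (resp. $\Pi_n$) formulas $\phi(x_1,\dots,x_m)$ in the language of $\mathbb{B}$; $\Sigma_0(\mathbb{B})=\Pi_0(\mathbb{B})$ is the set of all subsets definable by quantifier-free formulas. The sets $\Sigma_n(\mathbb{B})$, $\Pi_n(\mathbb{B})$ form the arithmetical hierarchy ${\mathcal H}(\mathbb{B})$; it collapses if $\Sigma_n(\mathbb{B})=\Sigma_{n+1}(\mathbb{B})$ for some $n$, and is proper otherwise. -}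

module Defs where

open import Algebra.Bundles using (Monoid)
import Algebra.Solver.Monoid.Expression as Expression
open import Data.Empty using (⊥)
open import Data.List.Base using (List; []; _∷_)
open import Data.List.Properties using (++-monoid)
open import Data.Nat.Base using (ℕ; zero; suc)
open import Data.Product.Base using (Σ-syntax; ∃-syntax; _×_; _,_)
open import Data.Sum.Base using (_⊎_)
open import Data.Vec.Base using (Vec; _∷_)
open import Function.Bundles using (_⇔_)
open import Level using (Level) renaming (zero to 0ℓ)
open import Relation.Binary.PropositionalEquality using (_≡_)
open import Relation.Nullary.Negation using (¬_)
open import Relation.Unary using (Pred)

𝕄 : Set → Monoid 0ℓ 0ℓ
𝕄 X = ++-monoid X

data Quantifier : Set where
  `∃ `∀ : Quantifier

alternations : List Quantifier → ℕ
alternations []             = 0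
alternations (q ∷ [])       = 0
alternations (`∃ ∷ `∃ ∷ qs) = alternations (`∃ ∷ qs)
alternations (`∀ ∷ `∀ ∷ qs) = alternations (`∀ ∷ qs)
alternations (`∃ ∷ `∀ ∷ qs) = suc (alternations (`∀ ∷ qs))
alternations (`∀ ∷ `∃ ∷ qs) = suc (alternations (`∃ ∷ qs))

-- Σ-formulas are the case q = `∃, Π-formulas the case q = `∀.
HasShape : Quantifier → ℕ → List Quantifier → Set
HasShape q zero    qs        = qs ≡ []
HasShape q (suc n) []        = ⊥
HasShape q (suc n) (q′ ∷ qs) = q′ ≡ q × alternations (q′ ∷ qs) ≡ n

module Hierarchy {ℓ : Level} (𝔹 : Monoid ℓ ℓ) where

  open Monoid 𝔹 using (Carrier; _≈_; rawMonoid)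
  open Expression rawMonoid public using (Expr; ⟦_⟧)

  infix  8 _`≈_
  infix  7 `¬_
  infixr 6 _`∧_
  infixr 5 _`∨_

  -- The index is the number of variables that may occur free.
  data QFFormula (m : ℕ) : Set where
    _`≈_      : Expr m → Expr m → QFFormula m
    `¬_       : QFFormula m → QFFormula m
    _`∧_ _`∨_ : QFFormula m → QFFormula m → QFFormula m

  -- A quantifier binds variable zero of the formula it is applied to.
  data PrenexFormula (m : ℕ) : Set where
    matrix : QFFormula m → PrenexFormula m
    quant  : Quantifier → PrenexFormula (suc m) → PrenexFormula m

  prefix : ∀ {m} → PrenexFormula m → List Quantifier
  prefix (matrix _)  = []
  prefix (quant q φ) = q ∷ prefix φ

  infix 4 _⊨₀_ _⊨_

  _⊨₀_ : ∀ {m} → Vec Carrier m → QFFormula m → Set ℓ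
  ρ ⊨₀ s `≈ t = ⟦ s ⟧ ρ ≈ ⟦ t ⟧ ρ
  ρ ⊨₀ `¬ φ   = ¬ (ρ ⊨₀ φ)
  ρ ⊨₀ φ `∧ ψ = (ρ ⊨₀ φ) × (ρ ⊨₀ ψ)
  ρ ⊨₀ φ `∨ ψ = (ρ ⊨₀ φ) ⊎ (ρ ⊨₀ ψ)

  -- Truth of first-order formulas is classical, so the existential
  -- quantifier is read without a witness; assuming excluded middle, the
  -- double negation can be dropped and this is Tarski's definition.  With the
  -- unnegated Σ-type, ∀∃-formulas would assert the existence of a choice
  -- function.  The other clauses need no double negation as long as _≈_
  -- is decidable, as it is in 𝕄 X for finite X: then _⊨₀_ is
  -- decidable and _⊨_ is stable under double negation.
  _⊨_ : ∀ {m} → Vec Carrier m → PrenexFormula m → Set ℓ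
  ρ ⊨ matrix φ   = ρ ⊨₀ φ
  ρ ⊨ quant `∃ φ = ¬ ¬ (∃[ x ] x ∷ ρ ⊨ φ)
  ρ ⊨ quant `∀ φ = ∀ x → x ∷ ρ ⊨ φ

  -- A subset of 𝔹ᵐ, together with m.
  Subset : Set _
  Subset = Σ[ m ∈ ℕ ] Pred (Vec Carrier m) ℓ

  Definable : Quantifier → ℕ → Pred Subset ℓ
  Definable q n (m , S) =
    ∃[ φ ] HasShape q n (prefix {m} φ) × (∀ ρ → S ρ ⇔ ρ ⊨ φ)

Σ[_] Π[_] : ∀ {ℓ} (n : ℕ) (𝔹 : Monoid ℓ ℓ) → Pred (Hierarchy.Subset 𝔹) ℓ
Σ[ n ] 𝔹 = Hierarchy.Definable 𝔹 `∃ n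
Π[ n ] 𝔹 = Hierarchy.Definable 𝔹 `∀ n

{-# OPTIONS --safe #-}

-- If Σₙ₊₁ ⊆ Σₙ, then Σₙ is closed under complement and projection, so every
-- definable set is Σₙ.  This contradicts Tarski's diagonal argument, once
-- satisfaction of coded Σₙ-formulas is seen to be definable, with two distinct
-- letters a and b as parameters.  A finite set of words is coded by listing its
-- members between copies of a separator aᴷ b longer than all of them; hence
-- finite valuations and straight-line programs can be coded.  Satisfaction of a
-- quantifier-free formula is the existence of a valuation that obeys the
-- program evaluating the formula.  A block of like quantifiers, whatever its
-- length, becomes a single quantifier over the valuations that extend the
-- current one, so that n such quantifiers suffice for all Σₙ-formulas.
module Submission where

open import Defs
open import Algebra.Bundles using (Monoid)
open import Algebra.Solver.Monoid.Expression using (var; id; _⊕_)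
open import Data.Bool.Base using (if_then_else_)
open import Data.Fin.Base using (Fin; zero; suc; lift; _↑ʳ_)
import Data.Fin.Properties as Fin
open import Data.List.Base using (List; []; _∷_; _++_; length; map; replicate; upTo)
open import Data.List.Membership.Propositional using (_∈_)
open import Data.List.Membership.Propositional.Properties using (∈-map⁺; ∈-map⁻; ∈-++⁺ˡ; ∈-++⁺ʳ; ∈-++⁻; ∈-upTo⁺; ∈-upTo⁻)
open import Data.List.Properties
open import Data.List.Relation.Unary.All as All using (All; []; _∷_)
open import Data.List.Relation.Unary.All.Properties using (map⁺; ++⁺; ++⁻ˡ; ++⁻ʳ)
open import Data.List.Relation.Unary.Any using (here; there)
open import Data.Nat.Base using (ℕ; zero; suc; _+_; _⊔_; _≤_; _<_; z≤n; s≤s)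
open import Data.Nat.Properties hiding (_≟_)
open import Data.Product.Base using (∃-syntax; _×_; _,_; proj₁; proj₂)
open import Data.Sum.Base using (_⊎_; inj₁; inj₂)
open import Data.Unit.Base using (⊤; tt)
open import Data.Vec.Base as Vec using (Vec; []; _∷_; lookup; tabulate; head; tail)
open import Data.Vec.Properties using (lookup∘tabulate; tabulate∘lookup; lookup-++ʳ)
open import Function.Base using (_∘_; case_of_) renaming (id to identity)
open import Function.Bundles using (_↔_; _⇔_; mk⇔; Equivalence; Injection; Inverse)
open import Function.Construct.Composition using (_⇔-∘_)
open import Function.Construct.Identity using (⇔-id)
open import Function.Properties.Inverse using (↔⇒↣; ↔-sym)
open import Function.Related.TypeIsomorphisms using (¬-cong-⇔)
open import Relation.Binary.Definitions using (Decidable; DecidableEquality)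
open import Relation.Binary.PropositionalEquality
open import Relation.Nullary.Decidable using (Dec; does; yes; no; ¬?; _×-dec_; _⊎-dec_; decidable-stable; via-injection)
open import Relation.Nullary.Negation using (¬_; Stable; contradiction; negated-stable; ¬¬-map)
open import Relation.Unary using (Pred; _≐_; _⊆_)

open Equivalence using (to; from)

-- Classical existence and the shapes of quantifier prefixes

⇔-trans : ∀ {a b c} {A : Set a} {B : Set b} {C : Set c} → A ⇔ B → B ⇔ C → A ⇔ C
⇔-trans f g = g ⇔-∘ f

∃ᶜ : ∀ {a b} {A : Set a} → (A → Set b) → Set _
∃ᶜ P = ¬ ¬ (∃[ x ] P x)

∃ᶜ-map : ∀ {a b c} {A : Set a} {P : A → Set b} {Q : A → Set c} →
         (∀ x → P x → Q x) → ∃ᶜ P → ∃ᶜ Q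
∃ᶜ-map f = ¬¬-map λ (x , p) → x , f x p

dual : Quantifier → Quantifier
dual `∃ = `∀
dual `∀ = `∃

alternations-dual : ∀ qs → alternations (map dual qs) ≡ alternations qs
alternations-dual []             = refl
alternations-dual (q ∷ [])       = refl
alternations-dual (`∃ ∷ `∃ ∷ qs) = alternations-dual (`∃ ∷ qs)
alternations-dual (`∀ ∷ `∀ ∷ qs) = alternations-dual (`∀ ∷ qs)
alternations-dual (`∃ ∷ `∀ ∷ qs) = cong suc (alternations-dual (`∀ ∷ qs))
alternations-dual (`∀ ∷ `∃ ∷ qs) = cong suc (alternations-dual (`∃ ∷ qs))

alternations-same : ∀ q qs → alternations (q ∷ q ∷ qs) ≡ alternations (q ∷ qs)
alternations-same `∃ qs = refl
alternations-same `∀ qs = refl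

alternations-dual∷ : ∀ q qs → alternations (q ∷ dual q ∷ qs) ≡ suc (alternations (dual q ∷ qs))
alternations-dual∷ `∃ qs = refl
alternations-dual∷ `∀ qs = refl

HasShape-dual : ∀ q n qs → HasShape q n qs → HasShape (dual q) n (map dual qs)
HasShape-dual q zero    []       refl       = refl
HasShape-dual q (suc n) (_ ∷ qs) (refl , p) = refl , trans (alternations-dual (q ∷ qs)) p

HasShape-dual∷ : ∀ q n qs → HasShape (dual q) n qs → HasShape q (suc n) (q ∷ qs)
HasShape-dual∷ q zero    []       refl       = refl , refl
HasShape-dual∷ q (suc n) (_ ∷ qs) (refl , p) =
  refl , trans (alternations-dual∷ q qs) (cong suc p)

HasShape-same∷ : ∀ q n qs → HasShape q (suc n) qs → HasShape q (suc n) (q ∷ qs)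
HasShape-same∷ q n (_ ∷ qs) (refl , p) = refl , trans (alternations-same q qs) p

-- Negation, renaming and conjunction of prenex formulas

module Prenex {ℓ} (𝔹 : Monoid ℓ ℓ) (_≟_ : Decidable (Monoid._≈_ 𝔹)) where

  open Monoid 𝔹 using (Carrier; _≈_; _∙_; ε) renaming (refl to ≈-refl)
  open Hierarchy 𝔹

  infix 4 _⊨₀?_
  _⊨₀?_ : ∀ {m} (ρ : Vec Carrier m) φ → Dec (ρ ⊨₀ φ)
  ρ ⊨₀? s `≈ t = ⟦ s ⟧ ρ ≟ ⟦ t ⟧ ρ
  ρ ⊨₀? `¬ φ   = ¬? (ρ ⊨₀? φ)
  ρ ⊨₀? φ `∧ ψ = (ρ ⊨₀? φ) ×-dec (ρ ⊨₀? ψ)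
  ρ ⊨₀? φ `∨ ψ = (ρ ⊨₀? φ) ⊎-dec (ρ ⊨₀? ψ)

  -- Equality is decidable, and `∃` carries its double negation by definition. Hence a classical
  -- witness may be unpacked whenever the goal is the truth of a formula.
  ⊨-stable : ∀ {m} {ρ : Vec Carrier m} φ → Stable (ρ ⊨ φ)
  ⊨-stable (matrix α)   = decidable-stable (_ ⊨₀? α)
  ⊨-stable (quant `∃ φ) = negated-stable
  ⊨-stable (quant `∀ φ) h x = ⊨-stable φ (¬¬-map (λ f → f x) h)

  neg : ∀ {m} → PrenexFormula m → PrenexFormula m
  neg (matrix α)  = matrix (`¬ α)
  neg (quant q φ) = quant (dual q) (neg φ)

  prefix-neg : ∀ {m} (φ : PrenexFormula m) → prefix (neg φ) ≡ map dual (prefix φ)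
  prefix-neg (matrix α)  = refl
  prefix-neg (quant q φ) = cong (dual q ∷_) (prefix-neg φ)

  ⊨-neg : ∀ {m} {ρ : Vec Carrier m} φ → (¬ (ρ ⊨ φ)) ⇔ (ρ ⊨ neg φ)
  ⊨-neg (matrix α)   = ⇔-id _
  ⊨-neg (quant `∃ φ) =
    mk⇔ (λ h x → to (⊨-neg φ) λ p → h λ k → k (x , p))
        (λ h k → k λ (x , p) → from (⊨-neg φ) (h x) p)
  ⊨-neg (quant `∀ φ) =
    mk⇔ (λ h k → h λ x → ⊨-stable φ λ p → k (x , to (⊨-neg φ) p))
        (λ h k → h λ (x , p) → from (⊨-neg φ) p (k x))

  pullback : ∀ {m n} → Vec Carrier n → (Fin m → Fin n) → Vec Carrier m
  pullback ρ f = tabulate (lookup ρ ∘ f)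

  renameᴱ : ∀ {m n} → (Fin m → Fin n) → Expr m → Expr n
  renameᴱ f (var i) = var (f i)
  renameᴱ f id      = id
  renameᴱ f (s ⊕ t) = renameᴱ f s ⊕ renameᴱ f t

  ⟦renameᴱ⟧ : ∀ {m n} (f : Fin m → Fin n) e ρ → ⟦ renameᴱ f e ⟧ ρ ≡ ⟦ e ⟧ (pullback ρ f)
  ⟦renameᴱ⟧ f (var i) ρ = sym (lookup∘tabulate (lookup ρ ∘ f) i)
  ⟦renameᴱ⟧ f id      ρ = refl
  ⟦renameᴱ⟧ f (s ⊕ t) ρ = cong₂ _∙_ (⟦renameᴱ⟧ f s ρ) (⟦renameᴱ⟧ f t ρ)

  rename₀ : ∀ {m n} → (Fin m → Fin n) → QFFormula m → QFFormula n
  rename₀ f (s `≈ t) = renameᴱ f s `≈ renameᴱ f t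
  rename₀ f (`¬ φ)   = `¬ rename₀ f φ
  rename₀ f (φ `∧ ψ) = rename₀ f φ `∧ rename₀ f ψ
  rename₀ f (φ `∨ ψ) = rename₀ f φ `∨ rename₀ f ψ

  ⊨₀-rename : ∀ {m n} (f : Fin m → Fin n) φ ρ → (ρ ⊨₀ rename₀ f φ) ≡ (pullback ρ f ⊨₀ φ)
  ⊨₀-rename f (s `≈ t) ρ = cong₂ _≈_ (⟦renameᴱ⟧ f s ρ) (⟦renameᴱ⟧ f t ρ)
  ⊨₀-rename f (`¬ φ)   ρ = cong ¬_ (⊨₀-rename f φ ρ)
  ⊨₀-rename f (φ `∧ ψ) ρ = cong₂ _×_ (⊨₀-rename f φ ρ) (⊨₀-rename f ψ ρ)
  ⊨₀-rename f (φ `∨ ψ) ρ = cong₂ _⊎_ (⊨₀-rename f φ ρ) (⊨₀-rename f ψ ρ)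

  -- All quantifiers of the first formula come before those of the second, so that conjunction with
  -- a true formula can prepend quantifiers to a prefix. The maps carry the variables of either
  -- formula into the common context, which grows under the quantifiers.
  merge : ∀ {m₁ m₂ m} → PrenexFormula m₁ → PrenexFormula m₂ →
          (Fin m₁ → Fin m) → (Fin m₂ → Fin m) → PrenexFormula m
  merge (quant q φ) ψ           f g = quant q (merge φ ψ (lift 1 f) (suc ∘ g))
  merge (matrix α)  (quant q ψ) f g = quant q (merge (matrix α) ψ (suc ∘ f) (lift 1 g))
  merge (matrix α)  (matrix β)  f g = matrix (rename₀ f α `∧ rename₀ g β)

  prefix-merge : ∀ {m₁ m₂ m} φ ψ (f : Fin m₁ → Fin m) (g : Fin m₂ → Fin m) →
                 prefix (merge φ ψ f g) ≡ prefix φ ++ prefix ψ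
  prefix-merge (quant q φ) ψ           f g = cong (q ∷_) (prefix-merge φ ψ _ _)
  prefix-merge (matrix α)  (quant q ψ) f g = cong (q ∷_) (prefix-merge (matrix α) ψ _ _)
  prefix-merge (matrix α)  (matrix β)  f g = refl

  ⊨-merge⁻ : ∀ {m₁ m₂ m} φ ψ (f : Fin m₁ → Fin m) (g : Fin m₂ → Fin m) ρ →
             ρ ⊨ merge φ ψ f g → pullback ρ f ⊨ φ × pullback ρ g ⊨ ψ
  ⊨-merge⁻ (quant `∃ φ) ψ f g ρ h =
    ∃ᶜ-map (λ x → proj₁ ∘ ⊨-merge⁻ φ ψ _ _ (x ∷ ρ)) h ,
    ⊨-stable ψ (¬¬-map (λ (x , p) → proj₂ (⊨-merge⁻ φ ψ _ _ (x ∷ ρ) p)) h)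
  ⊨-merge⁻ (quant `∀ φ) ψ f g ρ h =
    (λ x → proj₁ (⊨-merge⁻ φ ψ _ _ (x ∷ ρ) (h x))) ,
    -- ψ lies under the universal quantifier; the instance `ε` brings it out.
    proj₂ (⊨-merge⁻ φ ψ _ _ (ε ∷ ρ) (h ε))
  ⊨-merge⁻ (matrix α) (quant `∃ ψ) f g ρ h =
    decidable-stable (_ ⊨₀? α)
      (¬¬-map (λ (x , p) → proj₁ (⊨-merge⁻ (matrix α) ψ _ _ (x ∷ ρ) p)) h) ,
    ∃ᶜ-map (λ x → proj₂ ∘ ⊨-merge⁻ (matrix α) ψ _ _ (x ∷ ρ)) h
  ⊨-merge⁻ (matrix α) (quant `∀ ψ) f g ρ h =
    proj₁ (⊨-merge⁻ (matrix α) ψ _ _ (ε ∷ ρ) (h ε)) ,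
    (λ x → proj₂ (⊨-merge⁻ (matrix α) ψ _ _ (x ∷ ρ) (h x)))
  ⊨-merge⁻ (matrix α) (matrix β) f g ρ (p , q) =
    subst identity (⊨₀-rename f α ρ) p , subst identity (⊨₀-rename g β ρ) q

  ⊨-merge⁺ : ∀ {m₁ m₂ m} φ ψ (f : Fin m₁ → Fin m) (g : Fin m₂ → Fin m) ρ →
             pullback ρ f ⊨ φ → pullback ρ g ⊨ ψ → ρ ⊨ merge φ ψ f g
  ⊨-merge⁺ (quant `∃ φ) ψ f g ρ p q =
    ∃ᶜ-map (λ x p → ⊨-merge⁺ φ ψ _ _ (x ∷ ρ) p q) p
  ⊨-merge⁺ (quant `∀ φ) ψ f g ρ p q x = ⊨-merge⁺ φ ψ _ _ (x ∷ ρ) (p x) q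
  ⊨-merge⁺ (matrix α) (quant `∃ ψ) f g ρ p q =
    ∃ᶜ-map (λ x → ⊨-merge⁺ (matrix α) ψ _ _ (x ∷ ρ) p) q
  ⊨-merge⁺ (matrix α) (quant `∀ ψ) f g ρ p q x = ⊨-merge⁺ (matrix α) ψ _ _ (x ∷ ρ) p (q x)
  ⊨-merge⁺ (matrix α) (matrix β) f g ρ p q =
    subst identity (sym (⊨₀-rename f α ρ)) p , subst identity (sym (⊨₀-rename g β ρ)) q

  conj : ∀ {m} → PrenexFormula m → PrenexFormula m → PrenexFormula m
  conj φ ψ = merge φ ψ identity identity

  ⊨-conj : ∀ {m} φ ψ {ρ : Vec Carrier m} → (ρ ⊨ φ × ρ ⊨ ψ) ⇔ (ρ ⊨ conj φ ψ)
  ⊨-conj φ ψ {ρ} = mk⇔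
    (λ (p , q) → ⊨-merge⁺ φ ψ _ _ ρ (subst (_⊨ φ) (sym eq) p) (subst (_⊨ ψ) (sym eq) q))
    (λ h → let p , q = ⊨-merge⁻ φ ψ _ _ ρ h in subst (_⊨ φ) eq p , subst (_⊨ ψ) eq q)
    where
    eq : pullback ρ identity ≡ ρ
    eq = tabulate∘lookup ρ

  -- A shape prescribes the exact number of alternations. Conjunction with these true formulas
  -- supplies missing quantifiers in front.
  truth : ∀ {m} → Quantifier → ℕ → PrenexFormula m
  truth q zero    = matrix (id `≈ id)
  truth q (suc n) = quant q (truth (dual q) n)

  ⊨-truth : ∀ {m} q n {ρ : Vec Carrier m} → ρ ⊨ truth q n
  ⊨-truth q  zero    = ≈-refl
  ⊨-truth `∃ (suc n) k = k (ε , ⊨-truth `∀ n)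
  ⊨-truth `∀ (suc n) x = ⊨-truth `∃ n

  truth-shape : ∀ {m} q n → HasShape q n (prefix {m} (truth q n))
  truth-shape q zero    = refl
  truth-shape q (suc n) = HasShape-dual∷ q n _ (truth-shape (dual q) n)

  ⊨-conj-truth : ∀ {m} q n φ {ρ : Vec Carrier m} → (ρ ⊨ φ) ⇔ (ρ ⊨ conj (truth q n) φ)
  ⊨-conj-truth q n φ = mk⇔ (λ p → to (⊨-conj (truth q n) φ) (⊨-truth q n , p))
                          (proj₂ ∘ from (⊨-conj (truth q n) φ))

  -- Consequences of a collapse

  Definable-resp : ∀ {q n m} {S T : Pred (Vec Carrier m) ℓ} →
                   (∀ ρ → T ρ ⇔ S ρ) → Definable q n (m , S) → Definable q n (m , T)
  Definable-resp S⇔T (φ , shape , φ⇔S) = φ , shape , λ ρ → ⇔-trans (S⇔T ρ) (φ⇔S ρ)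

  -- For n > 0 the new `∃` joins the leading block; for n = 0 it makes a Σ₁-formula, which the
  -- inclusion takes back to Σ₀.
  quantified : ∀ n → Σ[ suc n ] 𝔹 ⊆ Σ[ n ] 𝔹 → ∀ {m} (φ : PrenexFormula (suc m)) →
               HasShape `∃ n (prefix φ) → Definable `∃ n (m , (_⊨ quant `∃ φ))
  quantified zero    Σ₁⊆Σ₀ φ shape =
    Σ₁⊆Σ₀ (quant `∃ φ , HasShape-dual∷ `∃ 0 _ shape , λ ρ → ⇔-id _)
  quantified (suc n) _     φ shape =
    quant `∃ φ , HasShape-same∷ `∃ n _ shape , λ ρ → ⇔-id _

  module Collapse (n : ℕ) (Σₙ₊₁⊆Σₙ : Σ[ suc n ] 𝔹 ⊆ Σ[ n ] 𝔹) where

    complement : ∀ {m} {S : Pred (Vec Carrier m) ℓ} →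
                 Definable `∃ n (m , S) → Definable `∃ n (m , λ ρ → ¬ S ρ)
    complement (φ , shape , S⇔φ) = Σₙ₊₁⊆Σₙ
      -- The negation is a Πₙ-formula; the dummy `∃` in front makes it Σₙ₊₁.
      ( conj (truth `∃ 1) (neg φ)
      , subst (HasShape `∃ (suc n)) (sym (prefix-merge (truth `∃ 1) (neg φ) _ _))
          (HasShape-dual∷ `∃ n _ (subst (HasShape `∀ n) (sym (prefix-neg φ))
            (HasShape-dual `∃ n _ shape)))
      , λ ρ → ⇔-trans (¬-cong-⇔ (S⇔φ ρ)) (⇔-trans (⊨-neg φ) (⊨-conj-truth `∃ 1 (neg φ))) )

    projection : ∀ {m} {S : Pred (Vec Carrier (suc m)) ℓ} →
                 Definable `∃ n (suc m , S) → Definable `∃ n (m , λ ρ → ∃ᶜ λ x → S (x ∷ ρ))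
    projection (φ , shape , S⇔φ) = Definable-resp
      (λ ρ → mk⇔ (∃ᶜ-map λ x → to (S⇔φ (x ∷ ρ))) (∃ᶜ-map λ x → from (S⇔φ (x ∷ ρ))))
      (quantified n Σₙ₊₁⊆Σₙ φ shape)

    collapse : ∀ {m} (φ : PrenexFormula m) → Definable `∃ n (m , (_⊨ φ))
    collapse (matrix α) =
      conj (truth `∃ n) (matrix α)
      , subst (HasShape `∃ n)
          (sym (trans (prefix-merge (truth `∃ n) (matrix α) _ _) (++-identityʳ _)))
          (truth-shape `∃ n)
      , λ ρ → ⊨-conj-truth `∃ n (matrix α)
    collapse (quant `∃ φ) = projection (collapse φ)
    -- A universal quantifier is read as ¬∃¬, which the two closure properties cover.
    collapse (quant `∀ φ) = Definable-resp
      (λ ρ → mk⇔ (λ h k → k λ (x , ¬p) → ¬p (h x))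
                 (λ h x → ⊨-stable φ λ ¬p → h λ k → k (x , ¬p)))
      (complement (projection (complement (collapse φ))))

  -- Closure properties of definability with parameters

  -- The tuple κ provides parameters: its entries are constants for Term and Def.
  module Definability {k} (κ : Vec Carrier k) where

    Term : ∀ {m} → (Vec Carrier m → Carrier) → Set ℓ
    Term {m} f = ∃[ e ] ∀ ρ → ⟦ e ⟧ (ρ Vec.++ κ) ≡ f ρ

    Def : ∀ {m} → Pred (Vec Carrier m) ℓ → Set _
    Def {m} P = ∃[ φ ] ∀ ρ → P ρ ⇔ (ρ Vec.++ κ ⊨ φ)

    term-head : ∀ {m} → Term {suc m} head
    term-head = var zero , λ { (x ∷ ρ) → refl }

    term-tail : ∀ {m} {f : Vec Carrier m → Carrier} → Term f → Term (f ∘ tail)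
    term-tail (e , ⟦e⟧≡f) = renameᴱ suc e , λ { (x ∷ ρ) →
      trans (⟦renameᴱ⟧ suc e (x ∷ ρ Vec.++ κ))
            (trans (cong ⟦ e ⟧ (tabulate∘lookup (ρ Vec.++ κ))) (⟦e⟧≡f ρ)) }

    term-param : ∀ {m} (i : Fin k) → Term {m} (λ _ → lookup κ i)
    term-param {m} i = var (m ↑ʳ i) , λ ρ → lookup-++ʳ ρ κ i

    term-ε : ∀ {m} → Term {m} (λ _ → ε)
    term-ε = id , λ ρ → refl

    term-∙ : ∀ {m} {f g : Vec Carrier m → Carrier} → Term f → Term g → Term (λ ρ → f ρ ∙ g ρ)
    term-∙ (s , ⟦s⟧≡f) (t , ⟦t⟧≡g) = s ⊕ t , λ ρ → cong₂ _∙_ (⟦s⟧≡f ρ) (⟦t⟧≡g ρ)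

    def-stable : ∀ {m} {P : Pred (Vec Carrier m) ℓ} → Def P → ∀ ρ → Stable (P ρ)
    def-stable (φ , P⇔φ) ρ h = from (P⇔φ ρ) (⊨-stable φ (¬¬-map (to (P⇔φ ρ)) h))

    def-resp : ∀ {m} {P Q : Pred (Vec Carrier m) ℓ} → (∀ ρ → Q ρ ⇔ P ρ) → Def P → Def Q
    def-resp Q⇔P (φ , P⇔φ) = φ , λ ρ → ⇔-trans (Q⇔P ρ) (P⇔φ ρ)

    def-≈ : ∀ {m} {f g : Vec Carrier m → Carrier} → Term f → Term g → Def (λ ρ → f ρ ≈ g ρ)
    def-≈ (s , ⟦s⟧≡f) (t , ⟦t⟧≡g) = matrix (s `≈ t) , λ ρ →
      mk⇔ (subst₂ _≈_ (sym (⟦s⟧≡f ρ)) (sym (⟦t⟧≡g ρ))) (subst₂ _≈_ (⟦s⟧≡f ρ) (⟦t⟧≡g ρ))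

    def-¬ : ∀ {m} {P : Pred (Vec Carrier m) ℓ} → Def P → Def (λ ρ → ¬ P ρ)
    def-¬ (φ , P⇔φ) = neg φ , λ ρ → ⇔-trans (¬-cong-⇔ (P⇔φ ρ)) (⊨-neg φ)

    def-× : ∀ {m} {P Q : Pred (Vec Carrier m) ℓ} → Def P → Def Q → Def (λ ρ → P ρ × Q ρ)
    def-× (φ , P⇔φ) (ψ , Q⇔ψ) = conj φ ψ , λ ρ → ⇔-trans
      (mk⇔ (λ (p , q) → to (P⇔φ ρ) p , to (Q⇔ψ ρ) q)
           (λ (p , q) → from (P⇔φ ρ) p , from (Q⇔ψ ρ) q))
      (⊨-conj φ ψ)

    def-→ : ∀ {m} {P Q : Pred (Vec Carrier m) ℓ} → Def P → Def Q → Def (λ ρ → P ρ → Q ρ)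
    def-→ P Q = def-resp
      (λ ρ → mk⇔ (λ f (p , ¬q) → ¬q (f p)) (λ h p → def-stable Q ρ λ ¬q → h (p , ¬q)))
      (def-¬ (def-× P (def-¬ Q)))

    def-∃ : ∀ {m} {P : Carrier → Pred (Vec Carrier m) ℓ} →
            Def {suc m} (λ v → P (head v) (tail v)) → Def (λ ρ → ∃ᶜ λ x → P x ρ)
    def-∃ (φ , P⇔φ) = quant `∃ φ , λ ρ →
      mk⇔ (∃ᶜ-map λ x → to (P⇔φ (x ∷ ρ))) (∃ᶜ-map λ x → from (P⇔φ (x ∷ ρ)))

    def-∀ : ∀ {m} {P : Carrier → Pred (Vec Carrier m) ℓ} →
            Def {suc m} (λ v → P (head v) (tail v)) → Def (λ ρ → ∀ x → P x ρ)
    def-∀ (φ , P⇔φ) = quant `∀ φ , λ ρ →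
      mk⇔ (λ h x → to (P⇔φ (x ∷ ρ)) (h x)) (λ h x → from (P⇔φ (x ∷ ρ)) (h x))

-- Words over an alphabet with two distinct letters

module Words {X : Set} (_≟_ : DecidableEquality X) (a b : X) (a≢b : a ≢ b) where

  Word : Set
  Word = List X

  infix 4 _≟ᵂ_
  _≟ᵂ_ : DecidableEquality Word
  _≟ᵂ_ = ≡-dec _≟_

  open Hierarchy (𝕄 X) public
  open Prenex (𝕄 X) _≟ᵂ_ public
  open import Data.List.Membership.DecPropositional _≟ᵂ_ using (_∈?_)
  open Definability ((a ∷ []) ∷ (b ∷ []) ∷ []) public

  term-a : ∀ {m} → Term {m} (λ _ → a ∷ [])
  term-a = term-param zero

  term-b : ∀ {m} → Term {m} (λ _ → b ∷ [])
  term-b = term-param (suc zero)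

  a^_ : ℕ → Word
  a^ n = replicate n a

  ^-cancel : ∀ i j {t t′} → a^ i ++ b ∷ t ≡ a^ j ++ b ∷ t′ → i ≡ j × t ≡ t′
  ^-cancel zero    zero    refl = refl , refl
  ^-cancel zero    (suc j) eq   = contradiction (sym (∷-injectiveˡ eq)) a≢b
  ^-cancel (suc i) zero    eq   = contradiction (∷-injectiveˡ eq) a≢b
  ^-cancel (suc i) (suc j) eq   =
    let i≡j , t≡t′ = ^-cancel i j (∷-injectiveʳ eq) in cong suc i≡j , t≡t′

  levi : ∀ (p : Word) {q} p′ {q′} → p ++ q ≡ p′ ++ q′ →
         (∃[ d ] p′ ≡ p ++ d × q ≡ d ++ q′) ⊎ (∃[ d ] p ≡ p′ ++ d × q′ ≡ d ++ q)
  levi []      p′       eq = inj₁ (p′ , refl , eq)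
  levi (x ∷ p) []       eq = inj₂ (x ∷ p , refl , sym eq)
  levi (x ∷ p) (y ∷ p′) eq with ∷-injectiveˡ eq | levi p p′ (∷-injectiveʳ eq)
  ... | refl | inj₁ (d , p′≡ , q≡) = inj₁ (d , cong (x ∷_) p′≡ , q≡)
  ... | refl | inj₂ (d , p≡ , q′≡) = inj₂ (d , cong (x ∷_) p≡ , q′≡)

  -- Coding finite sets of words

  Factor : Word → Word → Set
  Factor w x = ∃ᶜ λ y → ∃ᶜ λ z → x ≡ y ++ w ++ z

  Code : Set
  Code = Word × Word

  -- A finite set {x₁, …, xᵣ} is coded by (s , s x₁ s x₂ s … s xᵣ s), where
  -- s = aᴷ b for some K that bounds the lengths of the xᵢ.
  infix 4 _∈ᶜ_
  _∈ᶜ_ : Word → Code → Set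
  x ∈ᶜ (s , u) = Factor (s ++ x ++ s) u × ¬ Factor s x

  module Separator (K : ℕ) where

    s : Word
    s = a^ K ++ b ∷ []

    s++ : ∀ t → s ++ t ≡ a^ K ++ b ∷ t
    s++ t = ++-assoc (a^ K) (b ∷ []) t

    length-s : length s ≡ suc K
    length-s = trans (length-++ (a^ K))
                     (trans (cong (_+ 1) (length-replicate K)) (+-comm K 1))

    []≢ : ∀ p {q} → [] ≢ p ++ s ++ q
    []≢ p {q} eq = case trans (sym length-s) (cong length s≡[]) of λ ()
      where
      s≡[] : s ≡ []
      s≡[] = ++-conicalˡ s q (++-conicalʳ p (s ++ q) (sym eq))

    -- Strip d letter by letter. If it ends after i letters, all within the run of j letters a, then
    -- the runs that remain have equal length, j - i = K; as j ≤ K, this forces i = 0.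
    ^-unbordered : ∀ j d {t t′} → j ≤ K → a^ j ++ b ∷ t ≡ d ++ a^ K ++ b ∷ t′ →
                   (d ≡ [] × j ≡ K) ⊎ (∃[ d′ ] d ≡ a^ j ++ b ∷ d′)
    ^-unbordered j       []      j≤K eq = inj₁ (refl , proj₁ (^-cancel j K eq))
    ^-unbordered zero    (x ∷ d) j≤K eq with refl ← ∷-injectiveˡ eq = inj₂ (d , refl)
    ^-unbordered (suc j) (x ∷ d) j<K eq
      with refl ← ∷-injectiveˡ eq
      with ^-unbordered j d (<⇒≤ j<K) (∷-injectiveʳ eq)
    ... | inj₁ (_ , refl)  = contradiction j<K (<-irrefl refl)
    ... | inj₂ (d′ , refl) = inj₂ (d′ , refl)

    unbordered : ∀ d {t t′} → s ++ t ≡ d ++ s ++ t′ → d ≡ [] ⊎ (∃[ d′ ] d ≡ s ++ d′)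
    unbordered d {t} {t′} eq
      with ^-unbordered K d ≤-refl (trans (sym (s++ t)) (trans eq (cong (d ++_) (s++ t′))))
    ... | inj₁ (d≡[] , _) = inj₁ d≡[]
    ... | inj₂ (d′ , d≡)  = inj₂ (d′ , trans d≡ (sym (s++ d′)))

    not-short : ∀ y z → ¬ (length (y ++ s ++ z) ≤ K)
    not-short y z short = <-irrefl refl (begin-strict
      K                    <⟨ n<1+n K ⟩
      suc K                ≡⟨ length-s ⟨
      length s             ≤⟨ m≤m+n (length s) (length z) ⟩
      length s + length z  ≡⟨ length-++ s ⟨
      length (s ++ z)      ≤⟨ m≤n+m (length (s ++ z)) (length y) ⟩
      length y + length (s ++ z) ≡⟨ length-++ y ⟨
      length (y ++ s ++ z) ≤⟨ short ⟩
      K ∎)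
      where open ≤-Reasoning

    -- The second occurrence of `s` cannot begin inside p: occurrences of `s` do not overlap
    -- properly, and p is too short to contain one.
    align : ∀ p q {t t′} → length p ≤ K → p ++ s ++ t ≡ q ++ s ++ t′ →
            ∃[ d ] q ≡ p ++ d × s ++ t ≡ d ++ s ++ t′
    align p q short eq with levi p q eq
    ... | inj₁ shift = shift
    ... | inj₂ (d , refl , eq′) with unbordered d eq′
    ...   | inj₁ refl       = [] , sym (trans (++-identityʳ _) (++-identityʳ q)) , sym eq′
    ...   | inj₂ (d′ , refl) = contradiction short (not-short q d′)

    pack : List Word → Word
    pack []       = []
    pack (x ∷ xs) = x ++ s ++ pack xs

    pack⁺ : ∀ {x xs} → x ∈ xs → ∃[ y ] ∃[ z ] s ++ pack xs ≡ y ++ (s ++ x ++ s) ++ z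
    pack⁺ {x} {_ ∷ xs} (here refl) = [] , pack xs , sym
      (trans (++-assoc s (x ++ s) (pack xs)) (cong (s ++_) (++-assoc x s (pack xs))))
    pack⁺ {x} {x₁ ∷ xs} (there x∈xs) with y , z , eq ← pack⁺ x∈xs =
      (s ++ x₁ ++ y) , z ,
      trans (cong (λ t → s ++ x₁ ++ t) eq)
            (trans (cong (s ++_) (sym (++-assoc x₁ y _))) (sym (++-assoc s (x₁ ++ y) _)))

    pack⁻ : ∀ {xs} → All (λ x → length x ≤ K) xs → ∀ {x} → ¬ Factor s x →
            ∀ y {z} → s ++ pack xs ≡ y ++ s ++ x ++ s ++ z → x ∈ xs
    pack⁻ [] {x} _ y eq with unbordered y eq
    ... | inj₁ refl = contradiction (++-cancelˡ s _ _ eq) ([]≢ x)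
    ... | inj₂ (y′ , refl) =
      contradiction (++-cancelˡ s _ _ (trans eq (++-assoc s y′ _))) ([]≢ y′)
    pack⁻ {x₁ ∷ xs} (short ∷ shorts) {x} s∤x y eq with unbordered y eq
    ... | inj₁ refl
      with d , refl , eq′ ← align x₁ x short (++-cancelˡ s _ _ eq)
      with unbordered d eq′
    ...   | inj₁ refl       = here (++-identityʳ x₁)
    ...   | inj₂ (d′ , refl) = contradiction (λ k → k (x₁ , λ k → k (d′ , refl))) s∤x
    pack⁻ {x₁ ∷ xs} (short ∷ shorts) {x} s∤x y eq | inj₂ (y′ , refl)
      with d , refl , eq′ ← align x₁ y′ short (++-cancelˡ s _ _ (trans eq (++-assoc s y′ _)))
      = there (pack⁻ shorts s∤x d eq′)

    pack-∈ᶜ : ∀ {xs} → All (λ x → length x ≤ K) xs → ∀ x → x ∈ᶜ (s , s ++ pack xs) ⇔ x ∈ xs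
    pack-∈ᶜ {xs} shorts x = mk⇔
      (λ (f , s∤x) → decidable-stable (x ∈? xs) λ x∉xs → f λ (y , g) → g λ (z , eq) →
        x∉xs (pack⁻ shorts s∤x y (trans eq (cong (y ++_)
          (trans (++-assoc s (x ++ s) z) (cong (s ++_) (++-assoc x s z)))))))
      (λ x∈xs → (λ k → let y , z , eq = pack⁺ x∈xs in k (y , λ k → k (z , eq))) ,
        λ f → f λ (y , g) → g λ (z , eq) →
          not-short y z (subst (λ w → length w ≤ K) eq (All.lookup shorts x∈xs)))

  longest : List Word → ℕ
  longest []       = 0
  longest (x ∷ xs) = length x ⊔ longest xs

  longest-bounds : ∀ xs → All (λ x → length x ≤ longest xs) xs
  longest-bounds []       = []
  longest-bounds (x ∷ xs) =
    m≤m⊔n (length x) (longest xs) ∷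
    All.map (λ p → ≤-trans p (m≤n⊔m (length x) (longest xs))) (longest-bounds xs)

  code : ∀ xs → ∃[ c ] ∀ x → x ∈ᶜ c ⇔ x ∈ xs
  code xs = (s , s ++ pack xs) , pack-∈ᶜ (longest-bounds xs)
    where open Separator (longest xs)

  -- Finite valuations as coded sets of address-value entries

  Entry : Code → Word → Word → Set
  Entry c p x = (p ++ b ∷ x ∈ᶜ c) × (∀ y → p ++ b ∷ y ∈ᶜ c → y ≡ x)

  -- Reads c as a total function on words: the value at p is the x of the
  -- unique entry p b x of c, and [] if there is no such entry or several.
  Value : Code → Word → Word → Set
  Value c p x = ¬ Entry c p x → (∀ y → ¬ Entry c p y) × x ≡ []

  Value-functional : ∀ c p {x y} → Value c p x → Value c p y → x ≡ y
  Value-functional c p {x} {y} vx vy = decidable-stable (x ≟ᵂ y) λ x≢y →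
    let ¬ex : ¬ Entry c p x
        ¬ex ex = proj₁ (vy λ ey → x≢y (proj₂ ey x (proj₁ ex))) x ex
        ¬ey : ¬ Entry c p y
        ¬ey ey = proj₁ (vx ¬ex) y ey
    in x≢y (trans (proj₂ (vx ¬ex)) (sym (proj₂ (vy ¬ey))))

  -- Any y with an entry is itself a value, so if there were no value, there would be no entry, and
  -- [] would be one. Totality provides a word at every address not yet in use.
  Value-total : ∀ c p → ∃ᶜ (Value c p)
  Value-total c p k = k ([] , λ _ → (λ y e → k (y , λ ¬e → contradiction e ¬e)) , refl)

  Value-stable : ∀ c p {x} → Stable (Value c p x)
  Value-stable c p h ¬e =
    (λ y e → h λ v → proj₁ (v ¬e) y e) ,
    decidable-stable (_ ≟ᵂ []) (¬¬-map (λ v → proj₂ (v ¬e)) h)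

  infix 4 _[_]↦_
  _[_]↦_ : Code → ℕ → Word → Set
  v [ i ]↦ x = Value v (a^ i) x

  -- Variables are addressed by de Bruijn levels, so that the address of a
  -- variable does not change when further variables are bound.
  level : ∀ {m} → Fin m → ℕ
  level {suc m} zero    = m
  level {suc m} (suc i) = level i

  Stores : ∀ {m} → Code → Vec Word m → Set
  Stores             v []      = ⊤
  Stores {suc m} v (x ∷ ρ) = v [ m ]↦ x × Stores v ρ

  Stores-lookup : ∀ {m v} {ρ : Vec Word m} → Stores v ρ → ∀ i → v [ level i ]↦ lookup ρ i
  Stores-lookup {ρ = x ∷ ρ} (vx , vρ) zero    = vx
  Stores-lookup {ρ = x ∷ ρ} (vx , vρ) (suc i) = Stores-lookup vρ i

  Stores-transfer : ∀ {m v v′} (ρ : Vec Word m) → Stores v ρ →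
                    (∀ k → k < m → ∀ x → v [ k ]↦ x → v′ [ k ]↦ x) → Stores v′ ρ
  Stores-transfer []      _         f = tt
  Stores-transfer (x ∷ ρ) (vx , vρ) f =
    f _ ≤-refl x vx , Stores-transfer ρ vρ λ k k<m → f k (m<n⇒m<1+n k<m)

  Stores-agree : ∀ {m v v′} (ρ : Vec Word m) → Stores v ρ → Stores v′ ρ →
                 ∀ k → k < m → ∀ x → v [ k ]↦ x → v′ [ k ]↦ x
  Stores-agree {suc m} {v} {v′} (y ∷ ρ) (vy , vρ) (v′y , v′ρ) k k<1+m x vx
    with m≤n⇒m<n∨m≡n (≤-pred k<1+m)
  ... | inj₁ k<m  = Stores-agree ρ vρ v′ρ k k<m x vx
  ... | inj₂ refl = subst (v′ [ m ]↦_) (Value-functional v (a^ m) vy vx) v′y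

  entries : ∀ {m} → Vec Word m → List Word
  entries             []      = []
  entries {suc m} (x ∷ ρ) = (a^ m ++ b ∷ x) ∷ entries ρ

  entries-< : ∀ {m} (ρ : Vec Word m) {i y} → a^ i ++ b ∷ y ∈ entries ρ → i < m
  entries-< {suc m} (x ∷ ρ) {i} (here eq) = s≤s (≤-reflexive (proj₁ (^-cancel i m eq)))
  entries-< {suc m} (x ∷ ρ) (there y∈)    = m<n⇒m<1+n (entries-< ρ y∈)

  entries-stores : ∀ {m v} (ρ : Vec Word m) →
                   (∀ i → i < m → ∀ y → a^ i ++ b ∷ y ∈ᶜ v ⇔ a^ i ++ b ∷ y ∈ entries ρ) →
                   Stores v ρ
  entries-stores             []      _ = tt
  entries-stores {suc m} {v} (x ∷ ρ) h =
    -- The premise of `Value` denies an entry that is present.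
    contradiction entry ,
    entries-stores ρ λ i i<m y → mk⇔
      (λ y∈v → case to (h i (m<n⇒m<1+n i<m) y) y∈v of λ where
        (here eq)  → contradiction (proj₁ (^-cancel i m eq)) (<⇒≢ i<m)
        (there y∈) → y∈)
      (from (h i (m<n⇒m<1+n i<m) y) ∘ there)
    where
    entry : Entry v (a^ m) x
    entry = from (h m ≤-refl x) (here refl) , λ y y∈v → case to (h m ≤-refl y) y∈v of λ where
      (here eq)  → proj₂ (^-cancel m m eq)
      (there y∈) → contradiction (entries-< ρ y∈) (<-irrefl refl)

  store : ∀ {m} (ρ : Vec Word m) → ∃[ v ] Stores v ρ
  store ρ = let v , v≡ = code (entries ρ) in v , entries-stores ρ λ _ _ y → v≡ _

  -- Quantifier-free formulas as circuits

  data Op : Set where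
    mul ne : Op

  apply : Op → Word → Word → Word
  apply mul x y = x ++ y
  apply ne  x y = if does (x ≟ᵂ y) then b ∷ [] else []

  -- The graph of `apply` in a form that a first-order formula can express.
  Result : Op → Word → Word → Word → Set
  Result mul x y z = z ≡ x ++ y
  Result ne  x y z = (x ≡ y → z ≡ b ∷ []) × (x ≢ y → z ≡ [])

  Result⇔apply : ∀ o x y z → Result o x y z ⇔ z ≡ apply o x y
  Result⇔apply mul x y z = ⇔-id _
  Result⇔apply ne  x y z with x ≟ᵂ y
  ... | yes x≡y = mk⇔ (λ (f , _) → f x≡y) (λ z≡ → (λ _ → z≡) , contradiction x≡y)
  ... | no  x≢y = mk⇔ (λ (_ , g) → g x≢y) (λ z≡ → (λ x≡y → contradiction x≡y x≢y) , λ _ → z≡)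

  data Circuit (N : ℕ) : Set where
    input : Fin N → Circuit N
    empty : Circuit N
    gate  : Op → Circuit N → Circuit N → Circuit N

  eval : ∀ {N} → Circuit N → Vec Word N → Word
  eval (input i)    ρ = lookup ρ i
  eval empty        ρ = []
  eval (gate o s t) ρ = apply o (eval s ρ) (eval t ρ)

  -- Negation of truth values, where [] stands for true: the comparison with [] gives [] exactly
  -- when t is not [].
  ∁ : ∀ {N} → Circuit N → Circuit N
  ∁ t = gate ne t empty

  exprCircuit : ∀ {N} → Expr N → Circuit N
  exprCircuit (var i) = input i
  exprCircuit id      = empty
  exprCircuit (s ⊕ t) = gate mul (exprCircuit s) (exprCircuit t)

  eval-exprCircuit : ∀ {N} (e : Expr N) ρ → eval (exprCircuit e) ρ ≡ ⟦ e ⟧ ρ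
  eval-exprCircuit (var i) ρ = refl
  eval-exprCircuit id      ρ = refl
  eval-exprCircuit (s ⊕ t) ρ = cong₂ _++_ (eval-exprCircuit s ρ) (eval-exprCircuit t ρ)

  -- The truth value of a formula is coded by [] for true and by any other
  -- word for false, which makes the product the conjunction.
  circuit : ∀ {N} → QFFormula N → Circuit N
  circuit (s `≈ t) = ∁ (gate ne (exprCircuit s) (exprCircuit t))
  circuit (`¬ φ)   = ∁ (circuit φ)
  circuit (φ `∧ ψ) = gate mul (circuit φ) (circuit ψ)
  circuit (φ `∨ ψ) = ∁ (gate mul (∁ (circuit φ)) (∁ (circuit ψ)))

  ne-≡[] : ∀ x y → (apply ne x y ≡ []) ⇔ (x ≢ y)
  ne-≡[] x y with x ≟ᵂ y
  ... | yes x≡y = mk⇔ (λ ()) (contradiction x≡y)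
  ... | no  x≢y = mk⇔ (λ _ → x≢y) (λ _ → refl)

  mul-≡[] : ∀ (x y : Word) → (x ++ y ≡ []) ⇔ (x ≡ [] × y ≡ [])
  mul-≡[] x y = mk⇔ (λ eq → ++-conicalˡ x y eq , ++-conicalʳ x y eq) λ { (refl , refl) → refl }

  circuit-correct : ∀ {N} (φ : QFFormula N) ρ → (eval (circuit φ) ρ ≡ []) ⇔ (ρ ⊨₀ φ)
  circuit-correct (s `≈ t) ρ = ⇔-trans (ne-≡[] _ []) (⇔-trans (¬-cong-⇔ (ne-≡[] _ _)) (mk⇔
    (λ h → subst₂ _≡_ s≡ t≡ (decidable-stable (_ ≟ᵂ _) h))
    (λ s≡t s≢t → s≢t (subst₂ _≡_ (sym s≡) (sym t≡) s≡t))))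
    where
    s≡ = eval-exprCircuit s ρ
    t≡ = eval-exprCircuit t ρ
  circuit-correct (`¬ φ)   ρ = ⇔-trans (ne-≡[] _ []) (¬-cong-⇔ (circuit-correct φ ρ))
  circuit-correct (φ `∧ ψ) ρ = ⇔-trans (mul-≡[] _ _) (mk⇔
    (λ (p , q) → to (circuit-correct φ ρ) p , to (circuit-correct ψ ρ) q)
    (λ (p , q) → from (circuit-correct φ ρ) p , from (circuit-correct ψ ρ) q))
  circuit-correct (φ `∨ ψ) ρ = ⇔-trans (ne-≡[] _ []) (⇔-trans (¬-cong-⇔ (mul-≡[] _ _)) (mk⇔
    (λ h → decidable-stable (ρ ⊨₀? φ `∨ ψ) λ ¬φ∨ψ → h
      ( from (ne-≡[] _ []) (¬φ∨ψ ∘ inj₁ ∘ to (circuit-correct φ ρ))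
      , from (ne-≡[] _ []) (¬φ∨ψ ∘ inj₂ ∘ to (circuit-correct ψ ρ))))
    (λ where
      (inj₁ p) (φ≢ , _) → to (ne-≡[] _ []) φ≢ (from (circuit-correct φ ρ) p)
      (inj₂ q) (_ , ψ≢) → to (ne-≡[] _ []) ψ≢ (from (circuit-correct ψ ρ) q))))

  -- Straight-line programs, their codes and their runs

  -- exec o k i j demands that the value at address k is the result of o on
  -- the values at i and j; keep n k says that address k is in use before the
  -- n-th quantifier block (counted from the matrix) is evaluated.
  data Instr : Set where
    exec : Op → ℕ → ℕ → ℕ → Instr
    keep : ℕ → ℕ → Instr

  opcode : Op → ℕ
  opcode mul = 0
  opcode ne  = 1

  quadruple : Word → Word → Word → Word → Word
  quadruple o p q r = o ++ b ∷ p ++ b ∷ q ++ b ∷ r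

  quadruple-injective : ∀ o k i j o′ k′ i′ j′ →
    quadruple (a^ o) (a^ k) (a^ i) (a^ j) ≡ quadruple (a^ o′) (a^ k′) (a^ i′) (a^ j′) →
    o ≡ o′ × k ≡ k′ × i ≡ i′ × j ≡ j′
  quadruple-injective o k i j o′ k′ i′ j′ eq =
    let o≡ , eq₁ = ^-cancel o o′ eq
        k≡ , eq₂ = ^-cancel k k′ eq₁
        i≡ , eq₃ = ^-cancel i i′ eq₂
    in o≡ , k≡ , i≡ , trans (sym (length-replicate j)) (trans (cong length eq₃) (length-replicate j′))

  -- The first exponent tells instructions apart: 0 and 1 are the opcodes, while 2 + n marks a
  -- `keep` for block n, with two components left empty.
  ⌜_⌝ : Instr → Word
  ⌜ exec o k i j ⌝ = quadruple (a^ opcode o) (a^ k) (a^ i) (a^ j)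
  ⌜ keep n k ⌝     = quadruple (a^ (2 + n)) (a^ k) [] []

  ⌜⌝-injective : ∀ ι κ → ⌜ ι ⌝ ≡ ⌜ κ ⌝ → ι ≡ κ
  ⌜⌝-injective (exec mul k i j) (exec mul k′ i′ j′) eq
    with _ , refl , refl , refl ← quadruple-injective 0 k i j 0 k′ i′ j′ eq = refl
  ⌜⌝-injective (exec mul k i j) (exec ne k′ i′ j′) eq
    with () , _ ← quadruple-injective 0 k i j 1 k′ i′ j′ eq
  ⌜⌝-injective (exec mul k i j) (keep n′ k′) eq
    with () , _ ← quadruple-injective 0 k i j (2 + n′) k′ 0 0 eq
  ⌜⌝-injective (exec ne k i j) (exec mul k′ i′ j′) eq
    with () , _ ← quadruple-injective 1 k i j 0 k′ i′ j′ eq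
  ⌜⌝-injective (exec ne k i j) (exec ne k′ i′ j′) eq
    with _ , refl , refl , refl ← quadruple-injective 1 k i j 1 k′ i′ j′ eq = refl
  ⌜⌝-injective (exec ne k i j) (keep n′ k′) eq
    with () , _ ← quadruple-injective 1 k i j (2 + n′) k′ 0 0 eq
  ⌜⌝-injective (keep n k) (exec mul k′ i′ j′) eq
    with () , _ ← quadruple-injective (2 + n) k 0 0 0 k′ i′ j′ eq
  ⌜⌝-injective (keep n k) (exec ne k′ i′ j′) eq
    with () , _ ← quadruple-injective (2 + n) k 0 0 1 k′ i′ j′ eq
  ⌜⌝-injective (keep n k) (keep n′ k′) eq
    with refl , refl , _ ← quadruple-injective (2 + n) k 0 0 (2 + n′) k′ 0 0 eq = refl

  program : ∀ P → ∃[ c ] ∀ ι → ⌜ ι ⌝ ∈ᶜ c ⇔ ι ∈ P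
  program P = let c , c≡ = code (map ⌜_⌝ P) in c , λ ι → ⇔-trans (c≡ ⌜ ι ⌝) (mk⇔
    (λ ι∈ → let κ , κ∈P , eq = ∈-map⁻ ⌜_⌝ ι∈ in subst (_∈ P) (sym (⌜⌝-injective ι κ eq)) κ∈P)
    (∈-map⁺ ⌜_⌝))

  Executes : Code → Op → Word → Word → Word → Set
  Executes v o p q r = ∀ x y z → Value v q x → Value v r y → Value v p z → Result o x y z

  -- A `keep` relates two valuations, so it demands nothing of a single one; its force lies in
  -- `Keeps`.
  Holds : Code → Instr → Set
  Holds v (exec o k i j) = Executes v o (a^ k) (a^ i) (a^ j)
  Holds v (keep n k)     = ⊤

  -- In end, out and compile, m is the first free address; compile puts the
  -- value of a gate after those of its inputs.
  end : ∀ {N} → Circuit N → ℕ → ℕ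
  end (input i)    m = m
  end empty        m = suc m
  end (gate o s t) m = suc (end t (end s m))

  out : ∀ {N} → Circuit N → ℕ → ℕ
  out (input i)    m = level i
  out empty        m = m
  out (gate o s t) m = end t (end s m)

  -- The equation x = x x has the single solution [].
  clear : ℕ → Instr
  clear k = exec mul k k k

  compile : ∀ {N} → Circuit N → ℕ → List Instr
  compile (input i)    m = []
  compile empty        m = clear m ∷ []
  compile (gate o s t) m =
    exec o (end t (end s m)) (out s m) (out t (end s m)) ∷ compile s m ++ compile t (end s m)

  -- The intended run: intermediate results are pushed onto σ, which fills the addresses below m, in
  -- the order in which `compile` assigns addresses.
  trace : ∀ {N m} (t : Circuit N) → Vec Word N → Vec Word m → Vec Word (end t m)
  trace (input i)    ρ σ = σ
  trace empty        ρ σ = [] ∷ σ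
  trace (gate o s t) ρ σ = eval (gate o s t) ρ ∷ trace t ρ (trace s ρ σ)

  module _ {N} {ρ : Vec Word N} (v : Code) where

    holds-exec : ∀ o k i j {x y} → v [ i ]↦ x → v [ j ]↦ y → v [ k ]↦ apply o x y →
                 Holds v (exec o k i j)
    holds-exec o k i j {x} {y} vi vj vk x′ y′ z′ vx′ vy′ vz′
      with refl ← Value-functional v (a^ i) vi vx′
         | refl ← Value-functional v (a^ j) vj vy′
      = from (Result⇔apply o x y z′) (Value-functional v (a^ k) vz′ vk)

    exec-value : ∀ o k i j {x y} → Holds v (exec o k i j) → v [ i ]↦ x → v [ j ]↦ y →
                 v [ k ]↦ apply o x y
    exec-value o k i j {x} {y} h vi vj =
      Value-stable v (a^ k) (¬¬-map
        (λ (z , vk) → subst (v [ k ]↦_) (to (Result⇔apply o x y z) (h x y z vi vj vk)) vk)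
        (Value-total v (a^ k)))

    clear-value : ∀ k → Holds v (clear k) → v [ k ]↦ []
    clear-value k h = Value-stable v (a^ k) (¬¬-map
      (λ (z , vk) → subst (v [ k ]↦_)
        (++-identityʳ-unique z (h z z z vk vk vk)) vk)
      (Value-total v (a^ k)))

    trace-tail : ∀ {m} (t : Circuit N) {σ : Vec Word m} → Stores v (trace t ρ σ) → Stores v σ
    trace-tail (input i)    vσ       = vσ
    trace-tail empty        (_ , vσ) = vσ
    trace-tail (gate o s t) (_ , vσ) = trace-tail s (trace-tail t vσ)

    trace-out : ∀ {m} (t : Circuit N) {σ : Vec Word m} → Stores v ρ →
                Stores v (trace t ρ σ) → v [ out t m ]↦ eval t ρ
    trace-out (input i)    vρ _        = Stores-lookup vρ i
    trace-out empty        _  (vm , _) = vm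
    trace-out (gate o s t) _  (vk , _) = vk

    trace-holds : ∀ {m} (t : Circuit N) {σ : Vec Word m} → Stores v ρ →
                  Stores v (trace t ρ σ) → All (Holds v) (compile t m)
    trace-holds         (input i)    vρ _         = []
    trace-holds {m = m} empty        vρ (vm , vσ) = holds-exec mul m m m vm vm vm ∷ []
    trace-holds {m = m} (gate o s t) vρ (vk , vσ) =
      holds-exec o _ (out s m) (out t (end s m)) (trace-out s vρ vs) (trace-out t vρ vσ) vk ∷
      ++⁺ (trace-holds s vρ vs) (trace-holds t vρ vσ)
      where
      vs = trace-tail t vσ

    holds-out : ∀ {m} (t : Circuit N) → Stores v ρ → All (Holds v) (compile t m) →
                v [ out t m ]↦ eval t ρ
    holds-out         (input i)    vρ _        = Stores-lookup vρ i
    holds-out {m}     empty        vρ (h ∷ []) = clear-value m h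
    holds-out {m}     (gate o s t) vρ (h ∷ hs) =
      exec-value o (end t (end s m)) (out s m) (out t (end s m)) h
        (holds-out s vρ (++⁻ˡ (compile s m) hs)) (holds-out t vρ (++⁻ʳ (compile s m) hs))

  -- A truth predicate for coded formulas with n quantifier blocks

  -- Commuting with the letter a characterises the powers of a, so being an address is expressed by
  -- a single equation.
  Power : Word → Set
  Power p = p ++ a ∷ [] ≡ a ∷ p

  power⁺ : ∀ k → Power (a^ k)
  power⁺ zero    = refl
  power⁺ (suc k) = cong (a ∷_) (power⁺ k)

  power⁻ : ∀ {p} → Power p → ∃[ k ] p ≡ a^ k
  power⁻ {[]}    _  = 0 , refl
  power⁻ {x ∷ p} eq with refl ← ∷-injectiveˡ eq with k , refl ← power⁻ {p} (∷-injectiveʳ eq) =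
    suc k , refl

  Obeys : Op → Code → Code → Set
  Obeys o c v = ∀ p q r → Power p → Power q → Power r →
    quadruple (a^ opcode o) p q r ∈ᶜ c → Executes v o p q r

  Keeps : ℕ → Code → Code → Code → Set
  Keeps n c v v′ = ∀ p → Power p → quadruple (a^ (2 + n)) p [] [] ∈ᶜ c →
    ∀ x → Value v p x → Value v′ p x

  -- The recursion is on the number of blocks and not on a formula. For fixed n this is therefore a
  -- first-order condition on c and v, in which the program c is mere data. At 0 it asserts that a
  -- successful run exists.
  Sat : Quantifier → ℕ → Code → Code → Set
  Sat q  zero    c v = ∃ᶜ λ v′ → Keeps 0 c v v′ × Obeys mul c v′ × Obeys ne c v′
  Sat `∃ (suc n) c v = ∃ᶜ λ v′ → Keeps (suc n) c v v′ × Sat `∀ n c v′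
  Sat `∀ (suc n) c v = ∀ v′ → Keeps (suc n) c v v′ → Sat `∃ n c v′

  Sat-stable : ∀ q n {c v} → Stable (Sat q n c v)
  Sat-stable q  zero    = negated-stable
  Sat-stable `∃ (suc n) = negated-stable
  Sat-stable `∀ (suc n) h v′ kp = Sat-stable `∃ n (¬¬-map (λ f → f v′ kp) h)

  -- Compiling prenex formulas block by block

  -- A prefix read blockwise: `more` adds a quantifier to the current block, `turn` closes the
  -- block, which may be empty.
  data Shaped : Quantifier → ℕ → ∀ {m} → PrenexFormula m → Set where
    base : ∀ {q m} (α : QFFormula m) → Shaped q 0 (matrix α)
    turn : ∀ {q n m} {φ : PrenexFormula m} → Shaped (dual q) n φ → Shaped q (suc n) φ
    more : ∀ {q n m} {φ : PrenexFormula (suc m)} →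
           Shaped q (suc n) φ → Shaped q (suc n) (quant q φ)

  shaped : ∀ {q n m} (φ : PrenexFormula m) → HasShape q n (prefix φ) → Shaped q n φ
  shaped {n = zero}          (matrix α)                 _              = base α
  shaped {n = suc zero}      (quant q (matrix α))       (refl , _)     = more (turn (base α))
  shaped {n = suc n} (quant `∃ (quant `∃ φ)) (refl , p) = more (shaped (quant `∃ φ) (refl , p))
  shaped {n = suc n} (quant `∀ (quant `∀ φ)) (refl , p) = more (shaped (quant `∀ φ) (refl , p))
  shaped {n = suc (suc n)} (quant `∃ (quant `∀ φ)) (refl , p) =
    more (turn (shaped (quant `∀ φ) (refl , suc-injective p)))
  shaped {n = suc (suc n)} (quant `∀ (quant `∃ φ)) (refl , p) =
    more (turn (shaped (quant `∃ φ) (refl , suc-injective p)))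

  keeps : ℕ → ℕ → List Instr
  keeps n m = map (keep n) (upTo m)

  -- compileFormula d is meant for evaluation before the n-th block is opened,
  -- compileBody d for evaluation inside that block.
  compileFormula compileBody : ∀ {q n m} {φ : PrenexFormula m} → Shaped q n φ → List Instr
  compileFormula {n = n} {m} d = keeps n m ++ compileBody d
  compileBody {m = m} (base α) = clear (out (circuit α) m) ∷ compile (circuit α) m
  compileBody         (turn d) = compileFormula d
  compileBody         (more d) = compileBody d

  -- Separates the `keep` instructions issued before a block from those of the program inside it,
  -- which have smaller rank.
  rank : Instr → ℕ
  rank (exec _ _ _ _) = 0
  rank (keep n _)     = suc n

  compile-rank : ∀ {N} (t : Circuit N) m → All (λ ι → rank ι ≤ 0) (compile t m)
  compile-rank (input i)    m = []
  compile-rank empty        m = z≤n ∷ []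
  compile-rank (gate o s t) m = z≤n ∷ ++⁺ (compile-rank s m) (compile-rank t (end s m))

  compileFormula-rank : ∀ {q n m} {φ : PrenexFormula m} (d : Shaped q n φ) →
                        All (λ ι → rank ι ≤ suc n) (compileFormula d)
  compileBody-rank : ∀ {q n m} {φ : PrenexFormula m} (d : Shaped q n φ) →
                     All (λ ι → rank ι ≤ n) (compileBody d)
  compileFormula-rank d = ++⁺ (map⁺ (All.universal (λ _ → ≤-refl) _))
                              (All.map m≤n⇒m≤1+n (compileBody-rank d))
  compileBody-rank (base α) = z≤n ∷ compile-rank (circuit α) _
  compileBody-rank (turn d) = compileFormula-rank d
  compileBody-rank (more d) = compileBody-rank d

  -- c may contain further instructions, but only for outer blocks.
  Codes : ℕ → Code → List Instr → Set
  Codes l c P = ∀ ι → rank ι ≤ l → ⌜ ι ⌝ ∈ᶜ c ⇔ ι ∈ P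

  ∈-keeps⁻ : ∀ {n m n′ k} → keep n′ k ∈ keeps n m → n′ ≡ n × k < m
  ∈-keeps⁻ ι∈ with _ , k∈ , refl ← ∈-map⁻ (keep _) ι∈ = refl , ∈-upTo⁻ k∈

  -- Correctness of the truth predicate

  module Correctness (c : Code) where

    KeepsBelow : ℕ → ℕ → Set
    KeepsBelow n m = ∀ k → ⌜ keep n k ⌝ ∈ᶜ c ⇔ k < m

    codes-keeps : ∀ {q n m} {φ : PrenexFormula m} (d : Shaped q n φ) →
                  Codes (suc n) c (compileFormula d) → KeepsBelow n m
    codes-keeps {n = n} {m} d C k = ⇔-trans (C (keep n k) ≤-refl) (mk⇔
      (λ ι∈ → case ∈-++⁻ (keeps n m) ι∈ of λ where
        (inj₁ ι∈) → proj₂ (∈-keeps⁻ ι∈)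
        (inj₂ ι∈) → contradiction (All.lookup (compileBody-rank d) ι∈) (<-irrefl refl))
      (∈-++⁺ˡ ∘ ∈-map⁺ (keep n) ∘ ∈-upTo⁺))

    codes-body : ∀ {q n m} {φ : PrenexFormula m} (d : Shaped q n φ) →
                 Codes (suc n) c (compileFormula d) → Codes n c (compileBody d)
    codes-body {n = n} {m} d C ι ι≤n = ⇔-trans (C ι (m≤n⇒m≤1+n ι≤n)) (mk⇔
      (λ ι∈ → case ∈-++⁻ (keeps n m) ι∈ of λ where
        (inj₂ ι∈) → ι∈
        (inj₁ ι∈) → case ∈-map⁻ (keep n) ι∈ of λ where
          (_ , _ , refl) → contradiction ι≤n (<-irrefl refl))
      (∈-++⁺ʳ (keeps n m)))

    -- Values are functional, so what is preserved is exactly the tuple ρ. The successors of v are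
    -- thus described without mention of v.
    keeps-stores : ∀ n {m v} {ρ : Vec Word m} → KeepsBelow n m → Stores v ρ →
                   ∀ v′ → Keeps n c v v′ ⇔ Stores v′ ρ
    keeps-stores n {m} {v} {ρ} K vρ v′ = mk⇔
      (λ kp → Stores-transfer ρ vρ λ k k<m → kp (a^ k) (power⁺ k) (from (K k) k<m))
      (λ v′ρ p pow p∈ x → case power⁻ pow of λ where
        (k , refl) → Stores-agree ρ vρ v′ρ k (to (K k) p∈) x)

    module _ {P} (C : Codes 0 c P) where

      obeys⇒holds : ∀ {v} → Obeys mul c v → Obeys ne c v → All (λ ι → rank ι ≤ 0) P → All (Holds v) P
      obeys⇒holds {v} om on r = All.tabulate λ ι∈ → holds _ ι∈ (All.lookup r ι∈)
        where
        holds : ∀ ι → ι ∈ P → rank ι ≤ 0 → Holds v ι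
        holds (exec mul k i j) ι∈ _ = om _ _ _ (power⁺ k) (power⁺ i) (power⁺ j) (from (C _ z≤n) ι∈)
        holds (exec ne  k i j) ι∈ _ = on _ _ _ (power⁺ k) (power⁺ i) (power⁺ j) (from (C _ z≤n) ι∈)
        holds (keep _ _)       _  _ = tt

      holds⇒obeys : ∀ {v} → All (Holds v) P → ∀ o → Obeys o c v
      holds⇒obeys hs o p q r pp pq pr ∈c with power⁻ pp | power⁻ pq | power⁻ pr
      ... | k , refl | i , refl | j , refl = All.lookup hs (to (C (exec o k i j) z≤n) ∈c)

    matrix-correct : ∀ {m q} (α : QFFormula m) {v ρ} → Codes 1 c (compileFormula (base {q} α)) →
                     Stores v ρ → (ρ ⊨₀ α) ⇔ Sat q 0 c v
    matrix-correct {m} {q} α {v} {ρ} C vρ = mk⇔ ⇒ ⇐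
      where
      t : Circuit m
      t = circuit α
      K : KeepsBelow 0 m
      K = codes-keeps (base {q} α) C
      C₀ : Codes 0 c (compileBody (base {q} α))
      C₀ = codes-body (base {q} α) C
      ⇒ : ρ ⊨₀ α → Sat q 0 c v
      ⇒ p k = k (v′ , from (keeps-stores 0 K vρ v′) v′ρ , obeys mul , obeys ne)
        where
        -- The witness records the run of the circuit, started on top of ρ itself.
        v′ : Code
        v′ = proj₁ (store (trace t ρ ρ))
        v′σ : Stores v′ (trace t ρ ρ)
        v′σ = proj₂ (store (trace t ρ ρ))
        v′ρ : Stores v′ ρ
        v′ρ = trace-tail v′ t v′σ
        -- The added `clear` instruction demands [] at the output address, that is, the truth of α.
        vout : v′ [ out t m ]↦ []
        vout = subst (v′ [ out t m ]↦_) (from (circuit-correct α ρ) p) (trace-out v′ t v′ρ v′σ)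
        obeys : ∀ o → Obeys o c v′
        obeys = holds⇒obeys C₀
          (holds-exec {ρ = ρ} v′ mul (out t m) (out t m) (out t m) vout vout vout ∷ trace-holds v′ t v′ρ v′σ)
      ⇐ : Sat q 0 c v → ρ ⊨₀ α
      ⇐ h = decidable-stable (ρ ⊨₀? α) (¬¬-map (λ (v′ , kp , om , on) →
        let v′ρ = to (keeps-stores 0 K vρ v′) kp in
        case obeys⇒holds C₀ om on (compileBody-rank (base {q} α)) of λ where
          (cleared ∷ holds) → to (circuit-correct α ρ)
            -- The output address holds the value of the circuit and, by `clear`, also []; so the
            -- two agree.
            (Value-functional v′ (a^ out t m) (holds-out v′ t v′ρ holds)
              (clear-value {ρ = ρ} v′ (out t m) cleared))) h)

    -- Satisfaction inside an open block, depending on ρ instead of a current valuation. This form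
    -- admits induction through the quantifiers of the block.
    SatBody : Quantifier → ℕ → ∀ {m} → Vec Word m → Set
    SatBody `∃ n ρ = ∃ᶜ λ v → Stores v ρ × Sat `∀ n c v
    SatBody `∀ n ρ = ∀ v → Stores v ρ → Sat `∃ n c v

    Sat⇔SatBody : ∀ q {n m v} {ρ : Vec Word m} → KeepsBelow (suc n) m → Stores v ρ →
                  SatBody q n ρ ⇔ Sat q (suc n) c v
    Sat⇔SatBody `∃ {n} K vρ = mk⇔
      (∃ᶜ-map λ v′ (v′ρ , p) → from (keeps-stores (suc n) K vρ v′) v′ρ , p)
      (∃ᶜ-map λ v′ (kp , p) → to (keeps-stores (suc n) K vρ v′) kp , p)
    Sat⇔SatBody `∀ {n} K vρ = mk⇔
      (λ h v′ kp → h v′ (to (keeps-stores (suc n) K vρ v′) kp))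
      (λ h v′ v′ρ → h v′ (from (keeps-stores (suc n) K vρ v′) v′ρ))

    formula-correct : ∀ {q n m} {φ : PrenexFormula m} (d : Shaped q n φ) {v} {ρ : Vec Word m} →
                      Codes (suc n) c (compileFormula d) → Stores v ρ → (ρ ⊨ φ) ⇔ Sat q n c v
    -- A single quantifier over valuations of ρ serves the whole block: each such valuation already
    -- has a value at the next address, hence extends to x ∷ ρ for some x.
    body-correct : ∀ {q n m} {φ : PrenexFormula m} (d : Shaped q (suc n) φ) (ρ : Vec Word m) →
                   Codes (suc n) c (compileBody d) → (ρ ⊨ φ) ⇔ SatBody q n ρ

    formula-correct {q} {n = zero}  (base α) C vρ = matrix-correct {q = q} α C vρ
    formula-correct {q} {n = suc n} d        C vρ =
      ⇔-trans (body-correct d _ (codes-body d C)) (Sat⇔SatBody q (codes-keeps d C) vρ)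

    body-correct {`∃} {n} {φ = φ} (turn d) ρ C = mk⇔ {B = SatBody `∃ n ρ}
      (λ p k → let v , vρ = store ρ in k (v , vρ , to (formula-correct d C vρ) p))
      (λ h → ⊨-stable φ λ ¬p → h λ (v , vρ , s) → ¬p (from (formula-correct d C vρ) s))
    body-correct {`∀} (turn d) ρ C = mk⇔
      (λ p v vρ → to (formula-correct d C vρ) p)
      (λ h → let v , vρ = store ρ in from (formula-correct d C vρ) (h v vρ))
    body-correct {`∃} (more d) ρ C = mk⇔
      (λ p k → p λ (x , p) → to (body-correct d (x ∷ ρ) C) p λ (v , (_ , vρ) , s) → k (v , vρ , s))
      -- The witness for x is the word that v holds at the fresh address.
      (λ h k → h λ (v , vρ , s) → Value-total v (a^ _) λ (x , vx) →
        k (x , from (body-correct d (x ∷ ρ) C) λ k → k (v , (vx , vρ) , s)))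
    body-correct {`∀} {n} (more d) ρ C = mk⇔
      (λ p v vρ → Sat-stable `∃ n (¬¬-map
        (λ (x , vx) → to (body-correct d (x ∷ ρ) C) (p x) v (vx , vρ))
        (Value-total v (a^ _))))
      (λ h x → from (body-correct d (x ∷ ρ) C) λ v (_ , vρ) → h v vρ)

  -- Definability of the truth predicate

  record CodeTerm {m} (f : Vec Word m → Code) : Set where
    constructor codeTerm
    field
      separator : Term (proj₁ ∘ f)
      packed    : Term (proj₂ ∘ f)

  code-head : ∀ {m} → CodeTerm {suc (suc m)} (λ v → head v , head (tail v))
  code-head = codeTerm term-head (term-tail term-head)

  code-tail : ∀ {m} {f : Vec Word m → Code} → CodeTerm f → CodeTerm (f ∘ tail)
  code-tail (codeTerm s u) = codeTerm (term-tail s) (term-tail u)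

  code-tail² : ∀ {m} {f : Vec Word m → Code} → CodeTerm f → CodeTerm (f ∘ tail ∘ tail)
  code-tail² c = code-tail (code-tail c)

  def-∃-code : ∀ {m} {P : Code → Pred (Vec Word m) _} →
               Def {suc (suc m)} (λ v → P (head v , head (tail v)) (tail (tail v))) →
               Def (λ ρ → ∃ᶜ λ c → P c ρ)
  def-∃-code {P = P} D = def-resp
    (λ ρ → mk⇔ (λ h k → h λ ((s , u) , p) → k (u , λ k → k (s , p)))
               (λ h k → h λ (u , h) → h λ (s , p) → k ((s , u) , p)))
    (def-∃ {P = λ u ρ → ∃ᶜ λ s → P (s , u) ρ} (def-∃ D))

  def-∀-code : ∀ {m} {P : Code → Pred (Vec Word m) _} →
               Def {suc (suc m)} (λ v → P (head v , head (tail v)) (tail (tail v))) →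
               Def (λ ρ → ∀ c → P c ρ)
  def-∀-code {P = P} D = def-resp
    (λ ρ → mk⇔ (λ h u s → h (s , u)) (λ h (s , u) → h u s))
    (def-∀ {P = λ u ρ → ∀ s → P (s , u) ρ} (def-∀ D))

  private variable
    m : ℕ
    c v v′ : Vec Word m → Code
    o p q r w x y z : Vec Word m → Word

  def-Factor : Term w → Term x → Def (λ ρ → Factor (w ρ) (x ρ))
  def-Factor w x = def-∃ (def-∃ (def-≈ (term-tail (term-tail x))
    (term-∙ (term-tail term-head) (term-∙ (term-tail (term-tail w)) term-head))))

  def-∈ᶜ : Term x → CodeTerm c → Def (λ ρ → x ρ ∈ᶜ c ρ)
  def-∈ᶜ x (codeTerm s u) =
    def-× (def-Factor (term-∙ s (term-∙ x s)) u) (def-¬ (def-Factor s x))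

  def-Entry : CodeTerm c → Term p → Term x → Def (λ ρ → Entry (c ρ) (p ρ) (x ρ))
  def-Entry c p x = def-×
    (def-∈ᶜ (term-∙ p (term-∙ term-b x)) c)
    (def-∀ (def-→ (def-∈ᶜ (term-∙ (term-tail p) (term-∙ term-b term-head)) (code-tail c))
                  (def-≈ term-head (term-tail x))))

  def-Value : CodeTerm c → Term p → Term x → Def (λ ρ → Value (c ρ) (p ρ) (x ρ))
  def-Value c p x = def-→ (def-¬ (def-Entry c p x)) (def-×
    (def-∀ (def-¬ (def-Entry (code-tail c) (term-tail p) term-head)))
    (def-≈ x term-ε))

  def-Power : Term p → Def (λ ρ → Power (p ρ))
  def-Power p = def-≈ (term-∙ p term-a) (term-∙ term-a p)

  def-Result : ∀ o → Term x → Term y → Term z → Def (λ ρ → Result o (x ρ) (y ρ) (z ρ))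
  def-Result mul x y z = def-≈ z (term-∙ x y)
  def-Result ne  x y z = def-×
    (def-→ (def-≈ x y) (def-≈ z term-b))
    (def-→ (def-¬ (def-≈ x y)) (def-≈ z term-ε))

  term-^ : ∀ n → Term {m} (λ _ → a^ n)
  term-^ zero    = term-ε
  term-^ (suc n) = term-∙ term-a (term-^ n)

  term-quadruple : Term o → Term p → Term q → Term r →
                   Term (λ ρ → quadruple (o ρ) (p ρ) (q ρ) (r ρ))
  term-quadruple o p q r =
    term-∙ o (term-∙ term-b (term-∙ p (term-∙ term-b (term-∙ q (term-∙ term-b r)))))

  def-Executes : CodeTerm v → ∀ o → Term p → Term q → Term r →
                 Def (λ ρ → Executes (v ρ) o (p ρ) (q ρ) (r ρ))
  def-Executes v o p q r = def-∀ (def-∀ (def-∀ (def-→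
    (def-Value v³ (tail³ q) (term-tail (term-tail term-head)))
    (def-→ (def-Value v³ (tail³ r) (term-tail term-head))
      (def-→ (def-Value v³ (tail³ p) term-head)
        (def-Result o (term-tail (term-tail term-head)) (term-tail term-head) term-head))))))
    where
    tail³ : ∀ {f : Vec Word m → Word} → Term f → Term (f ∘ tail ∘ tail ∘ tail)
    tail³ t = term-tail (term-tail (term-tail t))
    v³ = code-tail (code-tail (code-tail v))

  def-Obeys : ∀ o → CodeTerm c → CodeTerm v → Def (λ ρ → Obeys o (c ρ) (v ρ))
  def-Obeys o c v = def-∀ (def-∀ (def-∀
    (def-→ (def-Power tp) (def-→ (def-Power tq) (def-→ (def-Power tr) (def-→
      (def-∈ᶜ (term-quadruple (term-^ (opcode o)) tp tq tr) (code-tail (code-tail² c)))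
      (def-Executes (code-tail (code-tail² v)) o tp tq tr)))))))
    where
    tp : Term {suc (suc (suc m))} (head ∘ tail ∘ tail)
    tp = term-tail (term-tail term-head)
    tq : Term {suc (suc (suc m))} (head ∘ tail)
    tq = term-tail term-head
    tr : Term {suc (suc (suc m))} head
    tr = term-head

  def-Keeps : ∀ n → CodeTerm c → CodeTerm v → CodeTerm v′ →
              Def (λ ρ → Keeps n (c ρ) (v ρ) (v′ ρ))
  def-Keeps n c v v′ = def-∀ (def-→ (def-Power term-head) (def-→
    (def-∈ᶜ (term-quadruple (term-^ (2 + n)) term-head term-ε term-ε) (code-tail c))
    (def-∀ (def-→
      (def-Value (code-tail² v) (term-tail term-head) term-head)
      (def-Value (code-tail² v′) (term-tail term-head) term-head)))))

  def-Sat : ∀ q n → CodeTerm c → CodeTerm v → Def (λ ρ → Sat q n (c ρ) (v ρ))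
  def-Sat q zero c v = def-∃-code (def-×
    (def-Keeps 0 (code-tail² c) (code-tail² v) code-head)
    (def-× (def-Obeys mul (code-tail² c) code-head) (def-Obeys ne (code-tail² c) code-head)))
  def-Sat `∃ (suc n) c v = def-∃-code (def-×
    (def-Keeps (suc n) (code-tail² c) (code-tail² v) code-head)
    (def-Sat `∀ n (code-tail² c) code-head))
  def-Sat `∀ (suc n) c v = def-∀-code (def-→
    (def-Keeps (suc n) (code-tail² c) (code-tail² v) code-head)
    (def-Sat `∃ n (code-tail² c) code-head))

  -- The diagonal argument

  -- The pairs (s , u) that do not satisfy the Σₙ-formula which they code.
  Diagonal : ℕ → Pred (Vec Word 2) _
  Diagonal n (s ∷ u ∷ []) =
    ∃ᶜ λ v → Stores v (s ∷ u ∷ (a ∷ []) ∷ (b ∷ []) ∷ []) × ¬ Sat `∃ n (s , u) v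

  def-Diagonal : ∀ n → Def (Diagonal n)
  def-Diagonal n = def-resp
    (λ { (s ∷ u ∷ []) → mk⇔
      (∃ᶜ-map λ v ((vs , vu , va , vb , _) , ¬s) → ((vs , vu) , (va , vb)) , ¬s)
      (∃ᶜ-map λ v (((vs , vu) , (va , vb)) , ¬s) → (vs , vu , va , vb , tt) , ¬s) })
    -- Addresses are levels, counted from the end of the tuple: s and u are at 3 and 2, the
    -- parameters a and b at 1 and 0.
    (def-∃-code {P = λ v ρ → ((v [ 3 ]↦ head ρ × v [ 2 ]↦ head (tail ρ)) ×
                              (v [ 1 ]↦ a ∷ [] × v [ 0 ]↦ b ∷ [])) × ¬ Sat `∃ n (head ρ , head (tail ρ)) v}
      (def-× (def-×
        (def-× (def-Value code-head (term-^ 3) (term-tail (term-tail term-head)))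
               (def-Value code-head (term-^ 2) (term-tail (term-tail (term-tail term-head)))))
        (def-× (def-Value code-head (term-^ 1) term-a) (def-Value code-head (term-^ 0) term-b)))
        (def-¬ (def-Sat `∃ n (code-tail² code-head) code-head))))

  -- Take for (s , u) the code of the program of φ. By correctness of `Sat`, this pair would be in
  -- the diagonal set exactly when it is not.
  Diagonal-not-Σ : ∀ n (φ : PrenexFormula 4) → HasShape `∃ n (prefix φ) →
    ¬ (∀ s u → Diagonal n (s ∷ u ∷ []) ⇔ (s ∷ u ∷ (a ∷ []) ∷ (b ∷ []) ∷ [] ⊨ φ))
  Diagonal-not-Σ n φ shape D⇔φ
    with isΣ ← shaped φ shape
    with (s , u) , codes ← program (compileFormula isΣ)
    with v₀ , v₀σ ← store (s ∷ u ∷ (a ∷ []) ∷ (b ∷ []) ∷ [])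
    = ∉Diagonal λ k → k (v₀ , v₀σ , ∉Diagonal ∘ from (D⇔φ s u) ∘ from (φ⇔Sat v₀σ))
    where
    φ⇔Sat : ∀ {t} → Stores t (s ∷ u ∷ (a ∷ []) ∷ (b ∷ []) ∷ []) →
            (s ∷ u ∷ (a ∷ []) ∷ (b ∷ []) ∷ [] ⊨ φ) ⇔ Sat `∃ n (s , u) t
    φ⇔Sat = Correctness.formula-correct (s , u) isΣ λ ι _ → codes ι
    ∉Diagonal : ¬ Diagonal n (s ∷ u ∷ [])
    ∉Diagonal ∈D = ∈D λ (_ , vσ , ¬sat) → ¬sat (to (φ⇔Sat vσ) (to (D⇔φ s u) ∈D))

  -- The parameters a and b become two further free variables, so the collapse applies and gives a
  -- Σₙ-formula in four variables.
  definable⇒proper : ∀ n → Def (Diagonal n) → ¬ (Σ[ suc n ] (𝕄 X) ⊆ Σ[ n ] (𝕄 X))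
  definable⇒proper n (φ , D⇔φ) Σₙ₊₁⊆Σₙ with Collapse.collapse n Σₙ₊₁⊆Σₙ φ
  ... | ψ , shape , φ⇔ψ =
    Diagonal-not-Σ n ψ shape λ s u → ⇔-trans (D⇔φ (s ∷ u ∷ [])) (φ⇔ψ _)

  Σ-proper : ∀ n → ¬ (Σ[ suc n ] (𝕄 X) ⊆ Σ[ n ] (𝕄 X))
  Σ-proper n = definable⇒proper n (def-Diagonal n)

corollary6 : (X : Set) (k : ℕ) → X ↔ Fin k → 2 ≤ k →
    (n : ℕ) → ¬ (Σ[ n ] (𝕄 X) ≐ Σ[ suc n ] (𝕄 X))
corollary6 X (suc (suc k)) X↔Fin (s≤s (s≤s _)) n (_ , Σₙ₊₁⊆Σₙ) =
  Words.Σ-proper _≟_ (Inverse.from X↔Fin zero) (Inverse.from X↔Fin (suc zero)) a≢b n Σₙ₊₁⊆Σₙ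
  where
  _≟_ : DecidableEquality X
  _≟_ = via-injection (↔⇒↣ X↔Fin) Fin._≟_
  a≢b : Inverse.from X↔Fin zero ≢ Inverse.from X↔Fin (suc zero)
  a≢b eq = contradiction (Injection.injective (↔⇒↣ (↔-sym X↔Fin)) eq) λ ()
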